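{- Let $p$ be a prime and let $n=p^e$ with $e\ge 1$ be a power of $p$. Let $S$ be a sequence of $2n-2$ integers coprime to $n$. Then $S$ has no subsequence of length at most $n$ whose sum $\sigma$ satisfies $\gcd(\sigma,n^2)=n$ if and only if there exists an integer $c$ coprime to $n$ such that $n-1$ terms of $S$ are congruent to $c$ modulo $np$ and the other $n-1$ terms of $S$ are congruent to $-c$ modulo $np$. In fact, such a sequence $S$ (i.e. one satisfying these equivalent conditions) has no subsequence (of any length) whose sum $\sigma$ satisfies $\gcd(\sigma,n^2)=n$.
   Context: Sequences are finite and unordered with repetition allowed (multisets); a subsequence is a sub-multiset, and its length is the number of its terms counted with multiplicity. -}

module Defs where

open import Data.Integer.Base using (ℤ; 0ℤ; +_; _+_; _-_)
open import Data.Integer.Divisibility using (_∣_)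
open import Data.Integer.GCD using (gcd)
open import Data.List.Base using (List; foldr; _++_)
open import Data.List.Relation.Binary.Permutation.Propositional using (_↭_)
open import Data.Nat.Base using (ℕ; _^_)
open import Data.Product.Base using (∃-syntax)
open import Relation.Binary.PropositionalEquality.Core using (_≡_)

infix 4 _≡_[mod_] _⊑_

_≡_[mod_] : ℤ → ℤ → ℕ → Set
a ≡ b [mod m ] = + m ∣ a - b

-- A finite multiset of integers is represented by a list, with lists that
-- differ by a permutation standing for the same multiset; T ⊑ S says that
-- the multiset T is contained in the multiset S.
_⊑_ : List ℤ → List ℤ → Set
T ⊑ S = ∃[ U ] T ++ U ↭ S

σ : List ℤ → ℤ
σ = foldr _+_ 0ℤ

GcdSum : ℕ → List ℤ → Set
GcdSum n T = gcd (σ T) (+ (n ^ 2)) ≡ + n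

{-# OPTIONS --safe #-}
module Submission where

-- Write N = np. The gcd condition says that n divides σ but N does not. Zero
-- sums modulo n split into zero sums of length at most n, so the length bound
-- is irrelevant: every zero sum modulo n must be a zero sum modulo N. If two
-- terms x, y are not congruent up to sign modulo N, put them into a part V of
-- n−1 terms. Adding a unit to a sequence enlarges its set of subsequence sums
-- unless that is everything, so V has at least 4 + (n−3) = n+1 sums modulo N,
-- while the n−1 remaining terms represent every residue modulo n. Two sums of V
-- agree modulo n and have a common completion to a zero sum, so they agree
-- modulo N: a contradiction (for n = 2 the sum x + y is even, hence 0 modulo 4).
-- So all terms are ±c, and n equal terms would have sum ±nc, not divisible by N.

open import Defs
open import Data.Integer.Base using (ℤ; +_; -_; 0ℤ; 1ℤ)
open import Data.Integer.Coprimality using (Coprime)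
open import Data.List.Base using (List; []; _∷_; length; _++_; take; drop)
open import Data.List.Relation.Binary.Permutation.Propositional
  using (_↭_; ↭-refl; ↭-sym; ↭-trans; ↭-reflexive; refl; prep; swap; trans)
open import Data.List.Relation.Unary.All using (All; []; _∷_)
open import Data.Nat.Base using (ℕ; zero; suc; _*_; _∸_; _^_; _≤_; _<_; s≤s; z≤n)
open import Data.Nat.Primality using (Prime)
open import Data.Product.Base using (_×_; _,_; ∃-syntax; proj₁; proj₂)
open import Function.Bundles using (_⇔_; mk⇔)
open import Relation.Binary.PropositionalEquality.Core using (_≡_; cong; subst; sym)
open import Relation.Nullary.Negation.Core using (¬_; contradiction)

import Data.Integer.Base as ℤ
import Data.Integer.Coprimality as ℤ
import Data.Integer.Divisibility.Signed as ℤ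
import Data.Integer.Properties as ℤ
open import Data.Integer.DivMod using (_%ℕ_; _/ℕ_; n%ℕd<d; a≡a%ℕn+[a/ℕn]*n)
open import Data.Integer.Tactic.RingSolver using (solve-∀)
import Data.Fin.Base as Fin
open import Data.Fin.Base using (Fin; zero; suc; toℕ; fromℕ<)
open import Data.Fin.Properties using (pigeonhole; any?; all?; toℕ<n; toℕ-fromℕ<)
open import Data.List.Properties
  using (take++drop≡id; take-take; length-take; length-drop; ++-identityʳ; length-++)
open import Data.List.Membership.Propositional using (_∈_)
open import Data.List.Membership.Propositional.Properties using (∈-∃++; ∈-++⁻)
open import Data.List.Relation.Binary.Permutation.Propositional.Properties
  using (++⁺; ++⁺ʳ; ++⁺ˡ; ++-comm; ++-commutativeMonoid; All-resp-↭; ∈-resp-↭; ↭-length; shift; drop-∷)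
open import Algebra.Bundles using (CommutativeMonoid)
open import Algebra.Properties.CommutativeSemigroup
  (CommutativeMonoid.commutativeSemigroup (++-commutativeMonoid {A = ℤ})) using (interchange)
import Data.List.Relation.Unary.All as All
import Data.List.Relation.Unary.All.Properties as All
open import Data.List.Relation.Unary.Any using (here)
import Data.Nat.Base as ℕ
import Data.Nat.Coprimality as ℕ
import Data.Nat.Divisibility as ℕ
import Data.Nat.GCD as ℕ
import Data.Nat.Primality as ℕ
import Data.Nat.Properties as ℕ
open import Data.Empty using (⊥-elim)
open import Data.Sum.Base using (_⊎_; inj₁; inj₂)
open import Relation.Binary.Definitions using (tri<; tri≈; tri>)
open import Relation.Binary.PropositionalEquality.Core using (refl)
  renaming (trans to ≡-trans)
open import Relation.Binary.PropositionalEquality.Properties using (module ≡-Reasoning)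
open import Relation.Nullary.Decidable using (Dec; yes; no; map′; ¬?)

-- Congruence

infix 4 _≈_[_]

-- An explicit quotient replaces the divisibility of absolute values behind `_≡_[mod_]`: matching on
-- the equation eliminates `a`, and the laws of congruence become ring identities.
data _≈_[_] (a b : ℤ) (m : ℕ) : Set where
  by : (q : ℤ) → a ≡ b ℤ.+ q ℤ.* + m → a ≈ b [ m ]

private
  variable
    a b c d : ℤ
    i j k m n : ℕ
    S T U V W : List ℤ

mod⇒≈ : a ≡ b [mod m ] → a ≈ b [ m ]
mod⇒≈ {a} {b} m∣a-b with ℤ.divides q eq ← ℤ.∣ᵤ⇒∣ m∣a-b =
  by q (≡-trans (identity a b) (cong (ℤ._+_ b) eq))
  where
  identity : ∀ a b → a ≡ b ℤ.+ (a ℤ.- b)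
  identity = solve-∀

≈⇒mod : a ≈ b [ m ] → a ≡ b [mod m ]
≈⇒mod {b = b} {m = m} (by q refl) = ℤ.∣⇒∣ᵤ (ℤ.divides q (identity b q (+ m)))
  where
  identity : ∀ b q m → b ℤ.+ q ℤ.* m ℤ.- b ≡ q ℤ.* m
  identity = solve-∀

≡⇒≈ : a ≡ b → a ≈ b [ m ]
≡⇒≈ {a} {m = m} refl = by 0ℤ (identity a (+ m))
  where
  identity : ∀ a m → a ≡ a ℤ.+ 0ℤ ℤ.* m
  identity = solve-∀

≈-sym : a ≈ b [ m ] → b ≈ a [ m ]
≈-sym {b = b} {m = m} (by q refl) = by (- q) (identity b q (+ m))
  where
  identity : ∀ b q m → b ≡ b ℤ.+ q ℤ.* m ℤ.+ - q ℤ.* m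
  identity = solve-∀

≈-trans : a ≈ b [ m ] → b ≈ c [ m ] → a ≈ c [ m ]
≈-trans {m = m} {c = c} (by q refl) (by r refl) = by (r ℤ.+ q) (identity c q r (+ m))
  where
  identity : ∀ c q r m → c ℤ.+ r ℤ.* m ℤ.+ q ℤ.* m ≡ c ℤ.+ (r ℤ.+ q) ℤ.* m
  identity = solve-∀

+-cong : a ≈ b [ m ] → c ≈ d [ m ] → a ℤ.+ c ≈ b ℤ.+ d [ m ]
+-cong {b = b} {m = m} {d = d} (by q refl) (by r refl) = by (q ℤ.+ r) (identity b d q r (+ m))
  where
  identity : ∀ b d q r m →
    b ℤ.+ q ℤ.* m ℤ.+ (d ℤ.+ r ℤ.* m) ≡ b ℤ.+ d ℤ.+ (q ℤ.+ r) ℤ.* m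
  identity = solve-∀

neg-cong : a ≈ b [ m ] → - a ≈ - b [ m ]
neg-cong {b = b} {m = m} (by q refl) = by (- q) (identity b q (+ m))
  where
  identity : ∀ b q m → - (b ℤ.+ q ℤ.* m) ≡ - b ℤ.+ - q ℤ.* m
  identity = solve-∀

+-cancelˡ : ∀ c → c ℤ.+ a ≈ c ℤ.+ b [ m ] → a ≈ b [ m ]
+-cancelˡ {a} {b} c c+a≈c+b =
  ≈-trans (≡⇒≈ (identity c a))
    (≈-trans (+-cong (≡⇒≈ {a = - c} refl) c+a≈c+b) (≡⇒≈ (sym (identity c b))))
  where
  identity : ∀ c a → a ≡ - c ℤ.+ (c ℤ.+ a)
  identity = solve-∀

a+b≈0⇒a≈-b : a ℤ.+ b ≈ 0ℤ [ m ] → a ≈ - b [ m ]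
a+b≈0⇒a≈-b {a} {b} a+b≈0 =
  ≈-trans (≡⇒≈ (identity a b)) (≈-trans (+-cong a+b≈0 (≡⇒≈ {a = - b} refl)) (≡⇒≈ (ℤ.+-identityˡ _)))
  where
  identity : ∀ a b → a ≡ a ℤ.+ b ℤ.+ - b
  identity = solve-∀

a≈-b⇒a+b≈0 : a ≈ - b [ m ] → a ℤ.+ b ≈ 0ℤ [ m ]
a≈-b⇒a+b≈0 {b = b} a≈-b = ≈-trans (+-cong a≈-b (≡⇒≈ {a = b} refl)) (≡⇒≈ (ℤ.+-inverseˡ b))

≈0⇒∣ : a ≈ 0ℤ [ m ] → m ℕ.∣ ℤ.∣ a ∣
≈0⇒∣ {a} {m} a≈0 = subst (m ℕ.∣_) (cong ℤ.∣_∣ (ℤ.+-identityʳ a)) (≈⇒mod a≈0)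

∣⇒≈0 : m ℕ.∣ ℤ.∣ a ∣ → a ≈ 0ℤ [ m ]
∣⇒≈0 {m} {a} m∣a = mod⇒≈ (subst (m ℕ.∣_) (cong ℤ.∣_∣ (sym (ℤ.+-identityʳ a))) m∣a)

≈-∣ : m ℕ.∣ n → a ≈ b [ n ] → a ≈ b [ m ]
≈-∣ m∣n a≈b = mod⇒≈ (ℕ.∣-trans m∣n (≈⇒mod a≈b))

_≈?_[_] : ∀ a b m → Dec (a ≈ b [ m ])
a ≈? b [ m ] = map′ mod⇒≈ ≈⇒mod (m ℕ.∣? ℤ.∣ a ℤ.- b ∣)

-- Every integer is congruent to its remainder by `n`, and there are only `n` remainders.
≈-pigeonhole : .{{_ : ℕ.NonZero n}} → n < k → (f : Fin k → ℤ) →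
  ∃[ i ] ∃[ j ] (i Fin.< j × f i ≈ f j [ n ])
≈-pigeonhole {n} n<k f with pigeonhole n<k (λ i → fromℕ< (n%ℕd<d (f i) n))
... | i , j , i<j , eq = i , j , i<j , ≈-trans (≈% (f i)) (≈-trans (≡⇒≈ (cong +_ eq′)) (≈-sym (≈% (f j))))
  where
  ≈% : ∀ a → a ≈ + (a %ℕ n) [ n ]
  ≈% a = by (a /ℕ n) (a≡a%ℕn+[a/ℕn]*n a n)
  eq′ : f i %ℕ n ≡ f j %ℕ n
  eq′ = ≡-trans (sym (toℕ-fromℕ< _)) (≡-trans (cong toℕ eq) (toℕ-fromℕ< _))

-- Multiples of a unit modulo m

unit-multiple : Coprime c (+ m) → + i ℤ.* c ≈ 0ℤ [ m ] → m ℕ.∣ i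
unit-multiple {c} {m} {i} c⊥m ic≈0 =
  ℤ.coprime-divisor (+ m) c (+ i) (ℕ.sym c⊥m)
    (subst (λ z → m ℕ.∣ ℤ.∣ z ∣) (ℤ.*-comm (+ i) c) (≈0⇒∣ ic≈0))

-- Cancelling `c` from the difference would make `m` divide `j ∸ i`, which is positive and less than
-- `m`.
multiples-distinct : Coprime c (+ m) → j < m → i < j → ¬ + i ℤ.* c ≈ + j ℤ.* c [ m ]
multiples-distinct {c} {m} {j} {i} c⊥m j<m i<j ic≈jc =
  ℕ.<⇒≱ (ℕ.≤-<-trans (ℕ.m∸n≤m j i) j<m) (ℕ.∣⇒≤ (unit-multiple c⊥m [j-i]c≈0))
  where
  instance _ = ℕ.>-nonZero (ℕ.m<n⇒0<n∸m i<j)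
  identity : ∀ i d c → (i ℤ.+ d) ℤ.* c ≡ i ℤ.* c ℤ.+ d ℤ.* c
  identity = solve-∀
  split : + j ℤ.* c ≡ + i ℤ.* c ℤ.+ + (j ∸ i) ℤ.* c
  split = ≡-trans (cong (λ z → + z ℤ.* c) (sym (ℕ.m+[n∸m]≡n (ℕ.<⇒≤ i<j)))) (identity (+ i) (+ (j ∸ i)) c)
  [j-i]c≈0 : + (j ∸ i) ℤ.* c ≈ 0ℤ [ m ]
  [j-i]c≈0 = +-cancelˡ (+ i ℤ.* c)
    (≈-trans (≡⇒≈ (sym split)) (≈-trans (≈-sym ic≈jc) (≡⇒≈ (sym (ℤ.+-identityʳ _)))))

multiples-injective : Coprime c (+ m) → i < m → j < m → + i ℤ.* c ≈ + j ℤ.* c [ m ] → i ≡ j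
multiples-injective {i = i} {j = j} c⊥m i<m j<m ic≈jc with ℕ.<-cmp i j
... | tri< i<j _ _ = contradiction ic≈jc (multiples-distinct c⊥m j<m i<j)
... | tri≈ _ i≡j _ = i≡j
... | tri> _ _ j<i = contradiction (≈-sym ic≈jc) (multiples-distinct c⊥m i<m j<i)

unit≉0 : 1 < m → Coprime c (+ m) → ¬ c ≈ 0ℤ [ m ]
unit≉0 {m} {c} 1<m c⊥m c≈0 =
  ℕ.>⇒≢ 1<m (c⊥m (≈0⇒∣ c≈0 , ℕ.∣-refl))

-- Sub-multisets and their sums

⊑-refl : T ⊑ T
⊑-refl {T} = [] , ↭-reflexive (++-identityʳ T)

⊑-trans : T ⊑ U → U ⊑ V → T ⊑ V
⊑-trans {T} (X , p) (Y , q) =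
  X ++ Y , ↭-trans (↭-sym (CommutativeMonoid.assoc ++-commutativeMonoid T X Y)) (↭-trans (++⁺ʳ Y p) q)

[]⊑ : [] ⊑ V
[]⊑ {V} = V , ↭-refl

⊑-keep : ∀ x → T ⊑ V → x ∷ T ⊑ x ∷ V
⊑-keep x (U , p) = U , prep x p

⊑-skip : ∀ x → T ⊑ V → T ⊑ x ∷ V
⊑-skip {T} x (U , p) = x ∷ U , ↭-trans (shift x T U) (prep x p)

⊑-++ : T ⊑ V → U ⊑ W → T ++ U ⊑ V ++ W
⊑-++ {T} {U = U} (X , p) (Y , q) = X ++ Y , ↭-trans (interchange T U X Y) (++⁺ p q)

σ-++ : ∀ T U → σ (T ++ U) ≡ σ T ℤ.+ σ U
σ-++ [] U = sym (ℤ.+-identityˡ (σ U))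
σ-++ (x ∷ T) U = ≡-trans (cong (ℤ._+_ x) (σ-++ T U)) (sym (ℤ.+-assoc x (σ T) (σ U)))

σ-↭ : T ↭ U → σ T ≡ σ U
σ-↭ refl = refl
σ-↭ (prep x p) = cong (ℤ._+_ x) (σ-↭ p)
σ-↭ {x ∷ y ∷ T} (swap x y p) rewrite σ-↭ p = identity x y _
  where
  identity : ∀ x y z → x ℤ.+ (y ℤ.+ z) ≡ y ℤ.+ (x ℤ.+ z)
  identity = solve-∀
σ-↭ (trans p q) = ≡-trans (σ-↭ p) (σ-↭ q)

σ-constant : All (λ a → a ≈ c [ m ]) T → σ T ≈ + length T ℤ.* c [ m ]
σ-constant {c} [] = ≡⇒≈ (sym (ℤ.*-zeroˡ c))
σ-constant {c} {T = _ ∷ T} (x≈c ∷ T≈c) =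
  ≈-trans (+-cong x≈c (σ-constant T≈c)) (≡⇒≈ (identity c (+ length T)))
  where
  identity : ∀ c l → c ℤ.+ l ℤ.* c ≡ (1ℤ ℤ.+ l) ℤ.* c
  identity = solve-∀

-- Sums of subsequences modulo m

-- A lower bound on the number of subsequence sums, witnessed by an indexed family: pigeonhole
-- arguments apply to it directly, and the set of all sums is never computed.
record DistinctSums (m : ℕ) (V : List ℤ) (k : ℕ) : Set where
  field
    sub      : Fin k → List ℤ
    sub⊑     : ∀ i → sub i ⊑ V
    distinct : ∀ i j → σ (sub i) ≈ σ (sub j) [ m ] → i ≡ j

open DistinctSums

emptySum : DistinctSums m V 1
emptySum .sub _ = []
emptySum .sub⊑ _ = []⊑
emptySum .distinct zero zero _ = refl

extend : (D : DistinctSums m V k) → T ⊑ V → (∀ i → ¬ σ (D .sub i) ≈ σ T [ m ]) →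
  DistinctSums m V (suc k)
extend {T = T} D T⊑V new .sub zero = T
extend D T⊑V new .sub (suc i) = D .sub i
extend D T⊑V new .sub⊑ zero = T⊑V
extend D T⊑V new .sub⊑ (suc i) = D .sub⊑ i
extend D T⊑V new .distinct zero zero _ = refl
extend D T⊑V new .distinct zero (suc j) eq = contradiction (≈-sym eq) (new j)
extend D T⊑V new .distinct (suc i) zero eq = contradiction eq (new i)
extend D T⊑V new .distinct (suc i) (suc j) eq = cong suc (D .distinct i j eq)

-- A set of residues closed under translation by a unit contains an orbit of length m.
translate-escapes : ∀ {u} → Coprime u (+ m) → suc k < m → (f : Fin (suc k) → ℤ) →
  ∃[ i ] (∀ j → ¬ f j ≈ u ℤ.+ f i [ m ])
translate-escapes {m} {k} {u} u⊥m k<m f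
  with any? (λ i → all? (λ j → ¬? (f j ≈? u ℤ.+ f i [ m ])))
... | yes found = found
... | no none = ⊥-elim (absurd (pigeonhole k<m (λ t → proj₁ (orbit (toℕ t)))))
  where
  next : ∀ i → ∃[ j ] f j ≈ u ℤ.+ f i [ m ]
  next i with any? (λ j → f j ≈? u ℤ.+ f i [ m ])
  ... | yes found = found
  ... | no none′ = contradiction (i , λ j eq → none′ (j , eq)) none
  identity : ∀ t u z → u ℤ.+ (z ℤ.+ t ℤ.* u) ≡ z ℤ.+ (1ℤ ℤ.+ t) ℤ.* u
  identity = solve-∀
  base : ∀ u z → z ≡ z ℤ.+ 0ℤ ℤ.* u
  base = solve-∀
  -- Closure lets the walk from `f zero` in steps of `u` continue indefinitely, but only `suc k`
  -- indices are available, so its first `m` positions repeat one.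
  orbit : ∀ t → ∃[ i ] f i ≈ f zero ℤ.+ + t ℤ.* u [ m ]
  orbit zero = zero , ≡⇒≈ (base u (f zero))
  orbit (suc t) with i , eq ← orbit t with j , eq′ ← next i =
    j , ≈-trans eq′ (≈-trans (+-cong (≡⇒≈ {a = u} refl) eq) (≡⇒≈ (identity (+ t) u (f zero))))
  absurd : ¬ (∃[ s ] ∃[ t ] (s Fin.< t × proj₁ (orbit (toℕ s)) ≡ proj₁ (orbit (toℕ t))))
  absurd (s , t , s<t , eq) =
    multiples-distinct u⊥m (toℕ<n t) s<t
      (+-cancelˡ (f zero)
        (≈-trans (≈-sym (proj₂ (orbit (toℕ s))))
          (≈-trans (≡⇒≈ (cong f eq)) (proj₂ (orbit (toℕ t))))))

-- A translate by `u` that escapes the known sums is itself a subsequence sum, obtained by adjoining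
-- `u`. The bound says that some residue is still missing.
grow : ∀ {u} → Coprime u (+ m) → suc k < m → DistinctSums m V (suc k) →
  DistinctSums m (u ∷ V) (suc (suc k))
grow {m} {k} {V} {u} u⊥m k<m D with i , new ← translate-escapes {u = u} u⊥m k<m (λ i → σ (D .sub i)) =
  extend D′ (⊑-keep u (D .sub⊑ i)) new
  where
  D′ : DistinctSums m (u ∷ V) (suc k)
  D′ .sub = D .sub
  D′ .sub⊑ i = ⊑-skip u (D .sub⊑ i)
  D′ .distinct = D .distinct

-- Each unit of `W` contributes one sum; the bound keeps the count before each step below `m`, as
-- `grow` requires.
growAll : All (λ s → Coprime s (+ m)) W → length W ℕ.+ suc k ≤ m → DistinctSums m V (suc k) →
  DistinctSums m (W ++ V) (length W ℕ.+ suc k)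
growAll [] _ D = D
growAll {m = m} {W = u ∷ W} {k = k} (u⊥m ∷ W⊥m) bound D =
  subst (DistinctSums _ _) (cong suc (sym (ℕ.+-suc (length W) k)))
    (grow u⊥m bound′
      (subst (DistinctSums _ _) (ℕ.+-suc (length W) k) (growAll W⊥m (ℕ.<⇒≤ bound) D)))
  where
  bound′ : suc (suc (length W ℕ.+ k)) ≤ m
  bound′ = subst (_≤ m) (cong suc (ℕ.+-suc (length W) k)) bound

-- The sums are 0, `x`, `y` and `x + y`. The two incongruences separate `x` from `y` and 0 from
-- `x + y`; any other coincidence would make a unit vanish.
fourSums : ∀ {x y} → 1 < m → Coprime x (+ m) → Coprime y (+ m) →
  ¬ x ≈ y [ m ] → ¬ x ≈ - y [ m ] → DistinctSums m (x ∷ y ∷ []) 4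
fourSums {m} {x} {y} 1<m x⊥m y⊥m x≉y x≉-y =
  extend (extend (extend emptySum x⊑ new-x) y⊑ new-y) ⊑-refl new-x+y
  where
  x⊑ : x ∷ [] ⊑ x ∷ y ∷ []
  x⊑ = ⊑-keep x []⊑
  y⊑ : y ∷ [] ⊑ x ∷ y ∷ []
  y⊑ = ⊑-skip x ⊑-refl
  +0 : ∀ x → x ℤ.+ 0ℤ ≈ x [ m ]
  +0 x = ≡⇒≈ (ℤ.+-identityʳ x)
  new-x : ∀ i → ¬ 0ℤ ≈ x ℤ.+ 0ℤ [ m ]
  new-x _ eq = unit≉0 1<m x⊥m (≈-sym (≈-trans eq (+0 x)))
  D₂ = extend emptySum x⊑ new-x
  new-y : ∀ i → ¬ σ (D₂ .sub i) ≈ y ℤ.+ 0ℤ [ m ]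
  -- `extend` puts the newest sum at index zero, so the cases here are `x` and 0, and below they are
  -- `y`, `x` and 0.
  new-y zero eq = x≉y (≈-trans (≈-sym (+0 x)) (≈-trans eq (+0 y)))
  new-y (suc zero) eq = unit≉0 1<m y⊥m (≈-sym (≈-trans eq (+0 y)))
  new-x+y : ∀ i → ¬ σ (extend D₂ y⊑ new-y .sub i) ≈ x ℤ.+ (y ℤ.+ 0ℤ) [ m ]
  new-x+y zero eq =
    unit≉0 1<m x⊥m (+-cancelˡ (y ℤ.+ 0ℤ)
      (≈-trans (≡⇒≈ (identity x y)) (≈-trans (≈-sym eq) (≈-sym (+0 (y ℤ.+ 0ℤ))))))
    where
    identity : ∀ x y → y ℤ.+ 0ℤ ℤ.+ x ≡ x ℤ.+ (y ℤ.+ 0ℤ)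
    identity = solve-∀
  new-x+y (suc zero) eq =
    unit≉0 1<m y⊥m (≈-sym (+-cancelˡ x (≈-trans eq (+-cong (≡⇒≈ {a = x} refl) (+0 y)))))
  new-x+y (suc (suc zero)) eq =
    x≉-y (a+b≈0⇒a≈-b (≈-sym (≈-trans eq (+-cong (≡⇒≈ {a = x} refl) (+0 y)))))

-- Together with `z` there are more than `m` values, so two agree; the sums are pairwise
-- incongruent, so one of the two is `z`.
all-residues : .{{_ : ℕ.NonZero m}} → m ≤ k → DistinctSums m V k →
  ∀ z → ∃[ T ] (T ⊑ V × σ T ≈ z [ m ])
all-residues {m} {k} {V} m≤k D z = answer (≈-pigeonhole (s≤s m≤k) values)
  where
  values : Fin (suc k) → ℤ
  values zero = z
  values (suc i) = σ (D .sub i)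
  answer : ∃[ i ] ∃[ j ] (i Fin.< j × values i ≈ values j [ m ]) → ∃[ T ] (T ⊑ V × σ T ≈ z [ m ])
  answer (zero , suc j , _ , eq) = D .sub j , D .sub⊑ j , ≈-sym eq
  answer (suc i , suc j , i<j , eq) =
    contradiction (cong toℕ (cong suc (D .distinct i j eq))) (ℕ.<⇒≢ i<j)


-- Zero sums modulo n that lift to zero sums modulo N

-- For `n` a power of `p` and `N` equal to `n * p`, this is the gcd condition on subsequences of
-- every length.
ZeroSumsLift : (n N : ℕ) → List ℤ → Set
ZeroSumsLift n N S = ∀ {T} → T ⊑ S → σ T ≈ 0ℤ [ n ] → σ T ≈ 0ℤ [ N ]

-- Two of the `n + 1` prefix sums of lengths 0 to `n` agree modulo `n`; the block `P` between the
-- two prefixes is the required zero sum.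
cut-zero-sum : .{{_ : ℕ.NonZero n}} → ∀ T → n ≤ length T →
  ∃[ P ] ∃[ R ] (P ++ R ↭ T × 0 < length P × length P ≤ n × σ P ≈ 0ℤ [ n ])
cut-zero-sum {n} T n≤T with ≈-pigeonhole (ℕ.n<1+n n) (λ i → σ (take (toℕ i) T))
... | i , j , s<t , eq =
  P , Q ++ X , perm ,
  subst (0 <_) (sym lengthP) (ℕ.m<n⇒0<n∸m s<t) ,
  subst (_≤ n) (sym lengthP) (ℕ.≤-trans (ℕ.m∸n≤m t s) t≤n) ,
  +-cancelˡ (σ Q) (≈-trans (≡⇒≈ (≡-trans (sym (σ-++ Q P)) (cong σ QP≡M)))
    (≈-trans (≈-sym eq) (≡⇒≈ (sym (ℤ.+-identityʳ (σ Q))))))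
  where
  s = toℕ i
  t = toℕ j
  t≤n : t ≤ n
  t≤n = ℕ.≤-pred (toℕ<n j)
  M = take t T
  P = drop s M
  Q = take s T
  X = drop t T
  QP≡M : Q ++ P ≡ M
  QP≡M = ≡-trans
    (cong (_++ P) (sym (≡-trans (take-take s t T) (cong (λ r → take r T) (ℕ.m≤n⇒m⊓n≡m (ℕ.<⇒≤ s<t))))))
    (take++drop≡id s M)
  perm : P ++ Q ++ X ↭ T
  perm = ↭-trans (↭-sym (CommutativeMonoid.assoc ++-commutativeMonoid P Q X))
    (↭-trans (++⁺ʳ X (++-comm P Q))
      (↭-reflexive (≡-trans (cong (_++ X) QP≡M) (take++drop≡id t T))))
  lengthP : length P ≡ t ∸ s
  lengthP = ≡-trans (length-drop s M)
    (cong (_∸ s) (≡-trans (length-take t T) (ℕ.m≤n⇒m⊓n≡m (ℕ.≤-trans t≤n n≤T))))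

-- Induction on a bound for the length: once a short zero sum is cut off, the remainder is a shorter
-- zero sum modulo `n`.
short-lift⇒lift : .{{_ : ℕ.NonZero n}} → ∀ {N} →
  (∀ {T} → T ⊑ S → length T ≤ n → σ T ≈ 0ℤ [ n ] → σ T ≈ 0ℤ [ N ]) → ZeroSumsLift n N S
short-lift⇒lift {n} {S} {N} short {T} T⊑S = go (length T) ℕ.≤-refl T⊑S
  where
  go : ∀ l {T} → length T ≤ l → T ⊑ S → σ T ≈ 0ℤ [ n ] → σ T ≈ 0ℤ [ N ]
  go zero {[]} _ _ _ = ≡⇒≈ refl
  go (suc l) {T} T≤l T⊑S σT≈0 with ℕ.≤-total (length T) n
  ... | inj₁ T≤n = short T⊑S T≤n σT≈0
  ... | inj₂ n≤T with P , R , perm , 0<P , P≤n , σP≈0 ← cut-zero-sum T n≤T =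
    ≈-trans (≡⇒≈ σT≡) (+-cong (short P⊑S P≤n σP≈0) (go l R≤l R⊑S σR≈0))
    where
    P⊑S = ⊑-trans (R , perm) T⊑S
    R⊑S = ⊑-trans (P , ↭-trans (++-comm R P) perm) T⊑S
    σT≡ : σ T ≡ σ P ℤ.+ σ R
    σT≡ = ≡-trans (sym (σ-↭ perm)) (σ-++ P R)
    σR≈0 : σ R ≈ 0ℤ [ n ]
    σR≈0 = +-cancelˡ (σ P) (≈-trans (≡⇒≈ (sym σT≡))
      (≈-trans σT≈0 (≈-sym (≈-trans (≡⇒≈ (ℤ.+-identityʳ (σ P))) σP≈0))))
    R≤l : length R ≤ l
    R≤l = ℕ.≤-pred (begin-strict
      length R                 <⟨ ℕ.m<n+m (length R) 0<P ⟩
      length P ℕ.+ length R    ≡⟨ length-++ P ⟨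
      length (P ++ R)          ≡⟨ ↭-length perm ⟩
      length T                 ≤⟨ T≤l ⟩
      suc l                    ∎)
      where open ℕ.≤-Reasoning

↭⇒⊑ : T ↭ U → T ⊑ U
↭⇒⊑ T↭U = ⊑-trans ⊑-refl ([] , ↭-trans (↭-reflexive (++-identityʳ _)) T↭U)

-- If W represents every residue modulo n, then every sum from V modulo n
-- completes to a zero sum; so it determines the sum modulo N.
few-sums : .{{_ : ℕ.NonZero n}} → ∀ {N l} → ZeroSumsLift n N (V ++ W) →
  n ≤ l → DistinctSums n W l → DistinctSums N V k → k ≤ n
few-sums {n} {V} {W} {k} {N} lift n≤l DW DV = ℕ.≮⇒≥ λ n<k → absurd (≈-pigeonhole n<k (λ i → σ (DV .sub i)))
  where
  complete : ∀ {T Z} → T ⊑ V → Z ⊑ W → σ T ≈ - σ Z [ n ] → σ T ≈ - σ Z [ N ]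
  complete {T} {Z} T⊑V Z⊑W eq =
    a+b≈0⇒a≈-b (≈-trans (≡⇒≈ (sym (σ-++ T Z)))
      (lift (⊑-++ T⊑V Z⊑W) (≈-trans (≡⇒≈ (σ-++ T Z)) (a≈-b⇒a+b≈0 eq))))
  absurd : ¬ (∃[ i ] ∃[ j ] (i Fin.< j × σ (DV .sub i) ≈ σ (DV .sub j) [ n ]))
  -- The same `Z` completes both colliding subsequences, so both sums equal `- σ Z` modulo `N`.
  absurd (i , j , i<j , eq) with Z , Z⊑W , σZ≈ ← all-residues n≤l DW (- σ (DV .sub i)) =
    ℕ.<⇒≢ i<j (cong toℕ (DV .distinct i j
      (≈-trans (complete (DV .sub⊑ i) Z⊑W i≈) (≈-sym (complete (DV .sub⊑ j) Z⊑W (≈-trans (≈-sym eq) i≈))))))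
    where
    i≈ : σ (DV .sub i) ≈ - σ Z [ n ]
    i≈ = ≈-trans (≡⇒≈ (sym (ℤ.neg-involutive _))) (neg-cong (≈-sym σZ≈))

-- Otherwise `x`, `y` and n - 3 further terms have n + 1 sums modulo `N`, one more than `few-sums`
-- allows. For n = 2 this choice of terms is impossible, hence the separate case.
units-agree-up-to-sign : ∀ {N x y R} → 1 < n → n < N → All (λ s → Coprime s (+ n)) S →
  All (λ s → Coprime s (+ N)) S → length S ≡ 2 * n ∸ 2 → ZeroSumsLift n N S →
  x ∷ y ∷ R ↭ S → x ≈ y [ N ] ⊎ x ≈ - y [ N ]
units-agree-up-to-sign {suc zero} (s≤s ()) _ _ _ _ _ _
units-agree-up-to-sign {2} {N = N} {x} {y} {[]} 1<n n<N S⊥n S⊥N len lift perm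
  with x⊥n ∷ y⊥n ∷ [] ← All-resp-↭ (↭-sym perm) S⊥n = inj₂ (from-collision (≈-pigeonhole (ℕ.n<1+n 2) values))
  where
  -- Two of these agree modulo 2. Units are not 0, so `x` agrees with `- y`, and the zero sum
  -- `x + y` lifts.
  values : Fin 3 → ℤ
  values zero = 0ℤ
  values (suc zero) = x
  values (suc (suc zero)) = - y
  conclude : x ≈ - y [ 2 ] → x ≈ - y [ N ]
  conclude eq = a+b≈0⇒a≈-b (≈-trans (≡⇒≈ (sym σxy))
    (lift (↭⇒⊑ perm) (≈-trans (≡⇒≈ σxy) (a≈-b⇒a+b≈0 eq))))
    where
    σxy : x ℤ.+ (y ℤ.+ 0ℤ) ≡ x ℤ.+ y
    σxy = cong (ℤ._+_ x) (ℤ.+-identityʳ y)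
  from-collision : ∃[ i ] ∃[ j ] (i Fin.< j × values i ≈ values j [ 2 ]) → x ≈ - y [ N ]
  from-collision (zero , suc zero , _ , eq) = contradiction (≈-sym eq) (unit≉0 1<n x⊥n)
  from-collision (zero , suc (suc zero) , _ , eq) =
    contradiction (≈-trans (≡⇒≈ (sym (ℤ.neg-involutive y))) (neg-cong (≈-sym eq))) (unit≉0 1<n y⊥n)
  from-collision (suc zero , suc (suc zero) , _ , eq) = conclude eq
  from-collision (suc zero , suc zero , s≤s () , _)
  from-collision (suc (suc zero) , suc zero , s≤s () , _)
  from-collision (suc (suc zero) , suc (suc zero) , s≤s (s≤s ()) , _)
units-agree-up-to-sign {2} {R = _ ∷ _} _ _ _ _ len _ perm
  with () ← ≡-trans (↭-length perm) len
units-agree-up-to-sign {n@(suc (suc (suc k)))} {S} {N} {x} {y} {R} 1<n n<N S⊥n S⊥N len lift perm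
  with x ≈? y [ N ] | x ≈? - y [ N ]
... | yes x≈y | _ = inj₁ x≈y
... | no _ | yes x≈-y = inj₂ x≈-y
... | no x≉y | no x≉-y with x⊥N ∷ y⊥N ∷ R⊥N ← All-resp-↭ (↭-sym perm) S⊥N
                          | _ ∷ _ ∷ R⊥n ← All-resp-↭ (↭-sym perm) S⊥n =
  contradiction (few-sums {W = Y ++ []} lift′ (ℕ.≤-reflexive (sym lengthW+1)) DW DV)
    (ℕ.<⇒≱ (ℕ.≤-reflexive (sym lengthP+4)))
  where
  -- Here `k` is n - 3, so `X` and `Y` have n - 1 terms each. The empty sum and the terms of `Y`
  -- yield n sums modulo `n`, which are all residues.
  P = take k R
  Y = drop k R
  X = P ++ x ∷ y ∷ []
  lengthR : length R ≡ k ℕ.+ suc (suc k)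
  lengthR = ℕ.suc-injective (ℕ.suc-injective (begin
    length (x ∷ y ∷ R)         ≡⟨ ↭-length perm ⟩
    length S                   ≡⟨ len ⟩
    2 * n ∸ 2                  ≡⟨⟩
    suc (k ℕ.+ (n ℕ.+ 0))      ≡⟨ cong (λ z → suc (k ℕ.+ z)) (ℕ.+-identityʳ n) ⟩
    suc (k ℕ.+ n)              ≡⟨ cong suc (ℕ.+-suc k (suc (suc k))) ⟩
    suc (suc (k ℕ.+ suc (suc k))) ∎))
    where open ≡-Reasoning
  lengthW+1 : length (drop k R) ℕ.+ 1 ≡ n
  lengthW+1 = ≡-trans (ℕ.+-comm _ 1) (cong suc (≡-trans (length-drop k R)
    (≡-trans (cong (_∸ k) lengthR) (ℕ.m+n∸m≡n k _))))
  lengthP+4 : length (take k R) ℕ.+ 4 ≡ suc n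
  lengthP+4 = ≡-trans (cong (ℕ._+ 4) (≡-trans (length-take k R)
    (ℕ.m≤n⇒m⊓n≡m (subst (k ≤_) (sym lengthR) (ℕ.m≤m+n k _))))) (ℕ.+-comm k 4)
  rearrange : X ++ Y ++ [] ↭ x ∷ y ∷ R
  rearrange = ↭-trans (↭-reflexive (cong (X ++_) (++-identityʳ Y)))
    (↭-trans (++⁺ʳ Y (++-comm P (x ∷ y ∷ [])))
      (↭-reflexive (cong (λ L → x ∷ y ∷ L) (take++drop≡id k R))))
  lift′ : ZeroSumsLift n N (X ++ Y ++ [])
  lift′ T⊑ = lift (⊑-trans T⊑ (↭⇒⊑ (↭-trans rearrange perm)))
  DW : DistinctSums n (Y ++ []) (length Y ℕ.+ 1)
  DW = growAll (All.drop⁺ k R⊥n) (ℕ.≤-reflexive lengthW+1) emptySum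
  DV : DistinctSums N X (length P ℕ.+ 4)
  DV = growAll (All.take⁺ k R⊥N) (subst (_≤ N) (sym lengthP+4) n<N)
    (fourSums (ℕ.<-trans 1<n n<N) x⊥N y⊥N x≉y x≉-y)

-- Sequences of terms ±c

separate : ∀ {P Q : ℤ → Set} → All (λ s → P s ⊎ Q s) S →
  ∃[ A ] ∃[ B ] (A ++ B ↭ S × All P A × All Q B)
separate [] = [] , [] , ↭-refl , [] , []
separate {x ∷ S} (inj₁ px ∷ pq) with A , B , perm , pA , qB ← separate pq =
  x ∷ A , B , prep x perm , px ∷ pA , qB
separate {x ∷ S} (inj₂ qx ∷ pq) with A , B , perm , pA , qB ← separate pq =
  A , x ∷ B , ↭-trans (shift x A B) (prep x perm) , pA , qx ∷ qB

-- A run of `n` terms would sum to `n` times `c`, which is 0 modulo `n`. Lifting and cancelling the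
-- unit `c` would make `N` divide the smaller `n`.
constant-run<n : ∀ {N} → .{{_ : ℕ.NonZero n}} → n < N → n ℕ.∣ N → Coprime c (+ N) → ZeroSumsLift n N S →
  T ⊑ S → All (λ a → a ≈ c [ N ]) T → length T < n
constant-run<n {n} {c} {T = T} {N} n<N n∣N c⊥N lift T⊑S T≈c = ℕ.≰⇒> λ n≤T →
  let
    lengthX : length (take n T) ≡ n
    lengthX = ≡-trans (length-take n T) (ℕ.m≤n⇒m⊓n≡m n≤T)
    σX≈nc : σ (take n T) ≈ + n ℤ.* c [ N ]
    σX≈nc = subst (λ l → σ (take n T) ≈ + l ℤ.* c [ N ]) lengthX (σ-constant (All.take⁺ n T≈c))
    nc≈0 : + n ℤ.* c ≈ 0ℤ [ n ]
    nc≈0 = by c (≡-trans (ℤ.*-comm (+ n) c) (sym (ℤ.+-identityˡ _)))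
    σX≈0 = lift (⊑-trans (drop n T , ↭-reflexive (take++drop≡id n T)) T⊑S)
      (≈-trans (≈-∣ n∣N σX≈nc) nc≈0)
  in ℕ.<⇒≱ n<N (ℕ.∣⇒≤ (unit-multiple c⊥N (≈-trans (≈-sym σX≈nc) σX≈0)))

remove : ∀ {x : ℤ} {A} → x ∈ A → ∃[ A′ ] A ↭ x ∷ A′
remove {x} x∈A with X , Y , refl ← ∈-∃++ x∈A = X ++ Y , shift x X Y

-- The subsequence T has i terms c and j terms −c; the latter are moved to the left-hand side.
signed-sum : ∀ T {U A B} → T ++ U ↭ A ++ B → All (λ a → a ≈ c [ m ]) A → All (λ b → b ≈ - c [ m ]) B →
  ∃[ i ] ∃[ j ] (i ≤ length A × j ≤ length B × σ T ℤ.+ + j ℤ.* c ≈ + i ℤ.* c [ m ])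
signed-sum [] _ _ _ = 0 , 0 , z≤n , z≤n , ≡⇒≈ (ℤ.+-identityˡ _)
signed-sum {c} {m} (x ∷ T) {U} {A} {B} perm A≈c B≈-c with ∈-++⁻ A (∈-resp-↭ perm (here refl))
... | inj₁ x∈A with A′ , A↭ ← remove x∈A with x≈c ∷ A′≈c ← All-resp-↭ A↭ A≈c
    with i , j , i≤ , j≤ , eq ← signed-sum T (drop-∷ (↭-trans perm (++⁺ʳ B A↭))) A′≈c B≈-c =
  suc i , j , subst (suc i ≤_) (sym (↭-length A↭)) (s≤s i≤) , j≤ ,
  ≈-trans (≡⇒≈ (ℤ.+-assoc x (σ T) _)) (≈-trans (+-cong x≈c eq) (≡⇒≈ (identity c (+ i))))
  where
  identity : ∀ c i → c ℤ.+ i ℤ.* c ≡ (1ℤ ℤ.+ i) ℤ.* c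
  identity = solve-∀
... | inj₂ x∈B with B′ , B↭ ← remove x∈B with x≈-c ∷ B′≈-c ← All-resp-↭ B↭ B≈-c
    with i , j , i≤ , j≤ , eq ← signed-sum T
      (drop-∷ (↭-trans perm (↭-trans (++⁺ˡ A B↭) (shift x A B′)))) A≈c B′≈-c =
  i , suc j , i≤ , subst (suc j ≤_) (sym (↭-length B↭)) (s≤s j≤) ,
  ≈-trans (≡⇒≈ (left x c (σ T) (+ j))) (≈-trans (+-cong (a≈-b⇒a+b≈0 x≈-c) eq) (≡⇒≈ (ℤ.+-identityˡ _)))
  where
  left : ∀ x c s j → x ℤ.+ s ℤ.+ (1ℤ ℤ.+ j) ℤ.* c ≡ x ℤ.+ c ℤ.+ (s ℤ.+ j ℤ.* c)
  left = solve-∀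

-- At `N` equal to `n * p` this unfolds to the structural side of the equivalence.
Balanced : (n N : ℕ) → List ℤ → Set
Balanced n N S = ∃[ c ] (Coprime c (+ n) × (∃[ A ] ∃[ B ] (A ++ B ↭ S ×
  length A ≡ n ∸ 1 × All (λ a → a ≡ c [mod N ]) A ×
  length B ≡ n ∸ 1 × All (λ b → b ≡ - c [mod N ]) B)))

≤n∸1⇒<n : .{{_ : ℕ.NonZero n}} → k ≡ n ∸ 1 → i ≤ k → i < n
≤n∸1⇒<n {n} refl i≤n∸1 = ℕ.≤-<-trans i≤n∸1 (ℕ.≤-reflexive (ℕ.suc-pred n))

-- The sum is `i - j` times `c`. If it vanishes modulo `n`, then `i` and `j`, both below `n`,
-- coincide, and it vanishes modulo `N` too.
balanced⇒lift : .{{_ : ℕ.NonZero n}} → ∀ {N} → n ℕ.∣ N → Balanced n N S → ZeroSumsLift n N S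
balanced⇒lift {n} n∣N (c , c⊥n , A , B , A++B↭S , lenA , A≡c , lenB , B≡-c) {T} (U , perm) σT≈0
  with i , j , i≤ , j≤ , eq ←
    signed-sum T (↭-trans perm (↭-sym A++B↭S)) (All.map mod⇒≈ A≡c) (All.map mod⇒≈ B≡-c)
  with refl ← multiples-injective {i = j} {j = i} c⊥n (≤n∸1⇒<n lenB j≤) (≤n∸1⇒<n lenA i≤)
    (≈-trans (≡⇒≈ (sym (ℤ.+-identityˡ _)))
      (≈-trans (+-cong (≈-sym σT≈0) (≡⇒≈ refl)) (≈-∣ n∣N eq))) =
  +-cancelˡ (+ i ℤ.* c) (≈-trans (≡⇒≈ (ℤ.+-comm (+ i ℤ.* c) (σ T)))
    (≈-trans eq (≡⇒≈ (sym (ℤ.+-identityʳ _)))))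

-- The first term serves as `c`. Each sign class has at most n - 1 terms, and the total 2n - 2
-- forces equality in both.
lift⇒balanced : ∀ {N} → 1 < n → n < N → n ℕ.∣ N → All (λ s → Coprime s (+ n)) S →
  All (λ s → Coprime s (+ N)) S → length S ≡ 2 * n ∸ 2 → ZeroSumsLift n N S →
  Balanced n N S
lift⇒balanced {suc zero} {[]} (s≤s ()) _ _ _ _ _ _
lift⇒balanced {suc (suc n)} {[]} _ _ _ _ _ len _ = contradiction (≡-trans len (ℕ.+-suc n _)) λ ()
lift⇒balanced {n = suc n} {S = c ∷ S} {N} 1<n n<N n∣N (c⊥n ∷ S⊥n) (c⊥N ∷ S⊥N) len lift
  with A , B , perm , A≈c , B≈-c ← separate {P = λ s → s ≈ c [ N ]} {Q = λ s → s ≈ - c [ N ]}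
         -- The head is handled apart, since `units-agree-up-to-sign` compares terms at two
         -- different positions.
         (inj₁ (≡⇒≈ refl) ∷ All.tabulate (λ {s} s∈S →
           units-agree-up-to-sign 1<n n<N (c⊥n ∷ S⊥n) (c⊥N ∷ S⊥N) len lift
             (↭-trans (swap s c ↭-refl) (prep c (↭-sym (proj₂ (remove s∈S))))))) =
  c , c⊥n , A , B , perm , lengthA , All.map ≈⇒mod A≈c , lengthB , All.map ≈⇒mod B≈-c
  where
  -- After matching on `suc n`, the variable `n` is one less than the modulus.
  A≤n : length A ≤ n
  A≤n = ℕ.≤-pred (constant-run<n n<N n∣N c⊥N lift (B , perm) A≈c)
  B≤n : length B ≤ n
  B≤n = ℕ.≤-pred (constant-run<n n<N n∣N (subst (λ a → ℕ.Coprime a N) (sym (ℤ.∣-i∣≡∣i∣ c)) c⊥N) lift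
    (A , ↭-trans (++-comm B A) perm) B≈-c)
  total : length A ℕ.+ length B ≡ n ℕ.+ n
  total = begin
    length A ℕ.+ length B  ≡⟨ length-++ A ⟨
    length (A ++ B)        ≡⟨ ↭-length perm ⟩
    length (c ∷ S)         ≡⟨ len ⟩
    n ℕ.+ suc (n ℕ.+ 0) ∸ 1  ≡⟨ cong (_∸ 1) (ℕ.+-suc n (n ℕ.+ 0)) ⟩
    n ℕ.+ (n ℕ.+ 0)        ≡⟨ cong (n ℕ.+_) (ℕ.+-identityʳ n) ⟩
    n ℕ.+ n                ∎
    where open ≡-Reasoning
  lengthA : length A ≡ n
  lengthA = ℕ.≤-antisym A≤n (ℕ.+-cancelʳ-≤ n n (length A)
    (ℕ.≤-trans (ℕ.≤-reflexive (sym total)) (ℕ.+-monoʳ-≤ (length A) B≤n)))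
  lengthB : length B ≡ n
  lengthB = ℕ.+-cancelˡ-≡ n _ _ (≡-trans (cong (ℕ._+ length B) (sym lengthA)) total)

-- The gcd condition

-- A common divisor of `i` and `j * k` is coprime to `j`, hence divides `k`.
coprime-* : ℕ.Coprime i j → ℕ.Coprime i k → ℕ.Coprime i (j * k)
coprime-* i⊥j i⊥k (d∣i , d∣jk) =
  i⊥k (d∣i , ℕ.coprime-divisor (λ (e∣d , e∣j) → i⊥j (ℕ.∣-trans e∣d d∣i , e∣j)) d∣jk)

coprime-^ : ∀ e → ℕ.Coprime i j → ℕ.Coprime i (j ^ e)
coprime-^ zero _ (_ , d∣1) = ℕ.∣1⇒≡1 d∣1
coprime-^ (suc e) i⊥j = coprime-* i⊥j (coprime-^ e i⊥j)

prime∤⇒coprime : ∀ {p} → Prime p → ¬ p ℕ.∣ i → ℕ.Coprime i p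
prime∤⇒coprime p-prime p∤i (d∣i , d∣p) with ℕ.prime⇒irreducible p-prime d∣p
... | inj₁ d≡1 = d≡1
... | inj₂ refl = contradiction d∣i p∤i

module _ {p e n : ℕ} (p-prime : Prime p) (n≡p^e : n ≡ p ^ e) .{{_ : ℕ.NonZero n}} where

  -- Write the gcd as `q * n`. It divides the square of `n`, so `q` divides the power `n` of `p`;
  -- but `p` dividing `q` would put `n * p` into `s`. Hence `q` is 1.
  gcd≡n : ∀ {s} → n ℕ.∣ s → ¬ n * p ℕ.∣ s → ℕ.gcd s (n ^ 2) ≡ n
  gcd≡n {s} n∣s np∤s with ℕ.gcd-greatest n∣s (ℕ.m∣m*n (n ^ 1))
  ... | ℕ.divides q gcd≡qn = ≡-trans gcd≡qn (≡-trans (cong (_* n) q≡1) (ℕ.*-identityˡ n))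
    where
    gcd∣s = ℕ.gcd[m,n]∣m s (n ^ 2)
    q∣n : q ℕ.∣ n
    q∣n = ℕ.*-cancelʳ-∣ n
      (subst (ℕ._∣ n * n) gcd≡qn
        (subst (ℕ.gcd s (n ^ 2) ℕ.∣_) (cong (n *_) (ℕ.*-identityʳ n)) (ℕ.gcd[m,n]∣n s (n ^ 2))))
    p∤q : ¬ p ℕ.∣ q
    p∤q p∣q = np∤s (ℕ.∣-trans (subst (n * p ℕ.∣_) (≡-trans (ℕ.*-comm n q) (sym gcd≡qn))
      (ℕ.*-monoʳ-∣ n p∣q)) gcd∣s)
    q≡1 : q ≡ 1
    q≡1 = coprime-^ e (prime∤⇒coprime p-prime p∤q) (ℕ.∣-refl , subst (q ℕ.∣_) n≡p^e q∣n)

  gcd≡n⇒n∣ : ∀ {s} → ℕ.gcd s (n ^ 2) ≡ n → n ℕ.∣ s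
  gcd≡n⇒n∣ {s} eq = subst (ℕ._∣ s) eq (ℕ.gcd[m,n]∣m s (n ^ 2))

  -- Since `p` divides `n`, `n * p` divides the square of `n`; dividing `s` as well, it would divide
  -- the gcd `n`, which is smaller.
  gcd≡n⇒np∤ : ∀ {s} → p ℕ.∣ n → n < n * p → ℕ.gcd s (n ^ 2) ≡ n → ¬ n * p ℕ.∣ s
  gcd≡n⇒np∤ p∣n n<np eq np∣s =
    ℕ.<⇒≱ n<np (ℕ.∣⇒≤ (subst (n * p ℕ.∣_) eq (ℕ.gcd-greatest np∣s
      (subst (n * p ℕ.∣_) (cong (n *_) (sym (ℕ.*-identityʳ n))) (ℕ.*-monoʳ-∣ n p∣n)))))

theorem1p5 : (p e n : ℕ) → Prime p → 1 ≤ e → n ≡ p ^ e →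
    (S : List ℤ) → length S ≡ 2 * n ∸ 2 → All (λ s → Coprime s (+ n)) S →
    ((¬ (∃[ T ] (T ⊑ S × length T ≤ n × GcdSum n T)))
      ⇔
     (∃[ c ] (Coprime c (+ n) ×
       (∃[ A ] ∃[ B ] (A ++ B ↭ S ×
         length A ≡ n ∸ 1 × All (λ a → a ≡ c [mod n * p ]) A ×
         length B ≡ n ∸ 1 × All (λ b → b ≡ - c [mod n * p ]) B)))))
    ×
    ((¬ (∃[ T ] (T ⊑ S × length T ≤ n × GcdSum n T))) →
      ¬ (∃[ T ] (T ⊑ S × GcdSum n T)))
theorem1p5 p e@(suc e′) n p-prime 1≤e n≡p^e S len S⊥n =
  -- All three implications pass through `ZeroSumsLift n (n * p) S`, in which no length bound
  -- occurs.
  mk⇔ (λ none → lift⇒balanced 1<n n<np (ℕ.m∣m*n p) S⊥n S⊥np len (none⇒lift none))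
      (λ balanced (T , T⊑S , _ , gcdT) → lift⇒none (balanced⇒lift (ℕ.m∣m*n p) balanced) T⊑S gcdT) ,
  λ none (T , T⊑S , gcdT) → lift⇒none (none⇒lift none) T⊑S gcdT
  where
  instance
    _ = ℕ.prime⇒nonZero p-prime
    n≢0 : ℕ.NonZero n
    n≢0 = subst ℕ.NonZero (sym n≡p^e) (ℕ.m^n≢0 p e)
  1<p : 1 < p
  1<p = ℕ.nonTrivial⇒n>1 p {{ℕ.prime⇒nonTrivial p-prime}}
  p∣n : p ℕ.∣ n
  p∣n = subst (p ℕ.∣_) (sym n≡p^e) (ℕ.m∣m*n (p ^ e′))
  1<n : 1 < n
  1<n = ℕ.<-≤-trans 1<p (ℕ.∣⇒≤ p∣n)
  n<np : n < n * p
  n<np = ℕ.m<m*n n p 1<p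
  S⊥np : All (λ s → Coprime s (+ (n * p))) S
  S⊥np = All.map (λ {s} → ⊥np {s}) S⊥n
    where
    ⊥np : ∀ {s} → Coprime s (+ n) → Coprime s (+ (n * p))
    ⊥np s⊥n = coprime-* s⊥n (λ (d∣s , d∣p) → s⊥n (d∣s , ℕ.∣-trans d∣p p∣n))

  none⇒lift : ¬ (∃[ T ] (T ⊑ S × length T ≤ n × GcdSum n T)) → ZeroSumsLift n (n * p) S
  none⇒lift none = short-lift⇒lift short
    where
    short : ∀ {T} → T ⊑ S → length T ≤ n → σ T ≈ 0ℤ [ n ] → σ T ≈ 0ℤ [ n * p ]
    -- Decidability of congruence turns the absence of a forbidden subsequence into a positive
    -- statement.
    short {T} T⊑S T≤n σT≈0 with σ T ≈? 0ℤ [ n * p ]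
    ... | yes σT≈0′ = σT≈0′
    ... | no σT≉0 = contradiction
      (T , T⊑S , T≤n , cong +_ (gcd≡n {e = e} p-prime n≡p^e (≈0⇒∣ σT≈0) (λ np∣ → σT≉0 (∣⇒≈0 np∣)))) none

  lift⇒none : ZeroSumsLift n (n * p) S → ∀ {T} → T ⊑ S → ¬ GcdSum n T
  lift⇒none lift T⊑S gcdT =
    gcd≡n⇒np∤ {e = e} p-prime n≡p^e p∣n n<np gcdT′
      (≈0⇒∣ (lift T⊑S (∣⇒≈0 (gcd≡n⇒n∣ {e = e} p-prime n≡p^e gcdT′))))
    where gcdT′ = ℤ.+-injective gcdT
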